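{- Every left-linear generalized semi-monadic TRS (GSM-TRS) $R$ is an EPRF-TRS.
   Context: A ranked alphabet $\Sigma$ is a finite set of symbols each with a rank in $\mathbb{N}$; $\Sigma_m$ is the set of symbols of rank $m$. $X=\{x_1,x_2,\dots\}$ is a countable set of variables, $T_\Sigma(X)$ the set of terms over $\Sigma$ and $X$, $T_\Sigma$ the ground terms. For a term $t$, $POS(t)$ is its set of positions (words over $\mathbb{N}$, $\lambda$ the root), $t/\alpha$ the subterm at $\alpha$, $var(t)$ its variables. A term is linear if no variable occurs twice in it. A term $u$ is a supertree of $v$ if $u$ is linear and $v=\sigma(u)$ for some substitution $\sigma$. A TRS $R$ over $\Sigma$ is a finite set of rules $l\to r$ with $l,r\in T_\Sigma(X)$ and $var(r)\subseteq var(l)$; $\Rightarrow_R$ is the one-step rewrite relation and $\Rightarrow_R^*$ its reflexive transitive closure. $R$ is left-linear if every left-hand side is linear. $sign(R)$ is the set of symbols occurring in rules of $R$. For a tree language $L\subseteq T_\Sigma$, $R^*_\Sigma(L)=\{p\mid q\Rightarrow^*_R p \text{ for some } q\in L\}$. A bottom-up tree automaton (bta) over $\Sigma$ is $(\Sigma,A,\Delta,A_f)$ with finite state set $A$ (states as constants), final states $A_f$, and rules $\delta(a_1,\dots,a_n)\to a$ ($\delta\in\Sigma_n$, $a_i,a\in A$) and $a\to a'$; it recognizes $\{t\in T_\Sigma\mid t\Rightarrow^* a \text{ for some } a\in A_f\}$. A TRS $R$ over $sign(R)$ is an EPRF-TRS if, given any ranked alphabet $\Sigma\supseteq sign(R)$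 and any finite tree language $L\subseteq T_\Sigma$, one can effectively construct a bta $\mathcal{C}$ over $\Sigma$ with $L(\mathcal{C})=R^*_\Sigma(L)$ (where $R$ is regarded as a TRS over $\Sigma$). A TRS $R$ over $\Sigma$ is a GSM-TRS if it has no rule $l\to r$ with $l\in X$, and the following holds: for any rules $l_1\to r_1$ and $l_2\to r_2$ in $R$, any positions $\alpha\in POS(r_1)$, $\beta\in POS(l_2)$, and any supertree $l_3\in T_\Sigma(X)$ of $l_2/\beta$ with $var(l_3)\cap var(l_1)=\emptyset$, if (i) $\alpha=\lambda$ or $\beta=\lambda$, (ii) $r_1/\alpha$ and $l_3$ are unifiable, and (iii) $\sigma$ is a most general unifier of $r_1/\alpha$ and $l_3$, then (a) $l_2/\beta\in X$, or (b) for each $\gamma\in POS(l_3)$, if $l_2/\beta\gamma\in X$ then $\sigma(l_3/\gamma)\in X\cup T_\Sigma$. -}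

module Defs where

open import Data.Nat using (ℕ; zero; suc)
open import Data.Fin using (Fin)
open import Data.Vec using (Vec; []; _∷_; lookup; _[_]≔_)
open import Data.List using (List; []; _∷_; _++_)
open import Data.List.Membership.Propositional using (_∈_)
open import Data.List.Relation.Unary.All using (All)
open import Data.Maybe using (Maybe; just; nothing)
open import Data.Product using (Σ; Σ-syntax; ∃; ∃-syntax; _×_; _,_; proj₁; proj₂)
open import Data.Sum using (_⊎_)
open import Relation.Nullary using (¬_)
open import Relation.Binary.PropositionalEquality using (_≡_)
open import Relation.Binary.Construct.Closure.ReflexiveTransitive using (Star)
open import Function.Bundles using (_⇔_)

-- A symbol is a pair (name , rank).  A ranked alphabet is a finite
-- set of symbols, represented as a list.
Sym : Set
Sym = ℕ × ℕ

rank : Sym → ℕ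
rank = proj₂

RankedAlphabet : Set
RankedAlphabet = List Sym

data Term : Set where
  var : ℕ → Term
  app : (f : Sym) → Vec Term (rank f) → Term

-- Positions and subterms: t / α  (positions are lists of 0-based
-- argument indices; [] is the root λ).  Undefined positions give nothing.

Pos : Set
Pos = List ℕ

mutual
  _/_ : Term → Pos → Maybe Term
  t / [] = just t
  var x / (i ∷ α) = nothing
  app f ts / (i ∷ α) = subV ts i α

  subV : ∀ {n} → Vec Term n → ℕ → Pos → Maybe Term
  subV [] i α = nothing
  subV (t ∷ ts) zero α = t / α
  subV (t ∷ ts) (suc i) α = subV ts i α

_∈POS_ : Pos → Term → Set
α ∈POS t = ∃[ s ] (t / α ≡ just s)

_∈var_ : ℕ → Term → Set
x ∈var t = ∃[ α ] (t / α ≡ just (var x))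

_occursIn_ : Sym → Term → Set
f occursIn t = ∃[ α ] ∃[ ts ] (t / α ≡ just (app f ts))

IsVar : Term → Set
IsVar t = ∃[ x ] (t ≡ var x)

Ground : Term → Set
Ground t = ∀ x → ¬ (x ∈var t)

OverAlph : RankedAlphabet → Term → Set
OverAlph Σ' t = ∀ f → f occursIn t → f ∈ Σ'

GroundOver : RankedAlphabet → Term → Set
GroundOver Σ' t = Ground t × OverAlph Σ' t

Linear : Term → Set
Linear t = ∀ x α β → t / α ≡ just (var x) → t / β ≡ just (var x) → α ≡ β

Subst : Set
Subst = ℕ → Term

mutual
  subst : Subst → Term → Term
  subst σ (var x) = σ x
  subst σ (app f ts) = app f (substV σ ts)

  substV : ∀ {n} → Subst → Vec Term n → Vec Term n
  substV σ [] = []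
  substV σ (t ∷ ts) = subst σ t ∷ substV σ ts

Supertree : Term → Term → Set
Supertree u v = Linear u × ∃[ σ ] (v ≡ subst σ u)

Unifier : Subst → Term → Term → Set
Unifier σ s t = subst σ s ≡ subst σ t

Unifiable : Term → Term → Set
Unifiable s t = ∃[ σ ] Unifier σ s t

MGU : Subst → Term → Term → Set
MGU σ s t = Unifier σ s t ×
  (∀ θ → Unifier θ s t → ∃[ ρ ] (∀ x → θ x ≡ subst ρ (σ x)))

Rule : Set
Rule = Term × Term

TRS : Set
TRS = List Rule

IsTRS : TRS → Set
IsTRS R = ∀ l r → (l , r) ∈ R → ∀ x → x ∈var r → x ∈var l

SignIn : TRS → RankedAlphabet → Set
SignIn R Σ' = ∀ l r → (l , r) ∈ R → OverAlph Σ' l × OverAlph Σ' r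

LeftLinear : TRS → Set
LeftLinear R = ∀ l r → (l , r) ∈ R → Linear l

data Step (R : TRS) : Term → Term → Set where
  root : ∀ {l r} → (l , r) ∈ R → (σ : Subst) → Step R (subst σ l) (subst σ r)
  cong : ∀ f (ts : Vec Term (rank f)) (i : Fin (rank f)) {u} →
         Step R (lookup ts i) u → Step R (app f ts) (app f (ts [ i ]≔ u))

Steps : TRS → Term → Term → Set
Steps R = Star (Step R)

InDescendants : TRS → List Term → Term → Set
InDescendants R L p = ∃[ q ] (q ∈ L × Steps R q p)

GSM : TRS → Set
GSM R =
  (∀ l r → (l , r) ∈ R → ¬ IsVar l) ×
  (∀ l₁ r₁ l₂ r₂ → (l₁ , r₁) ∈ R → (l₂ , r₂) ∈ R →
   ∀ (α β : Pos) (r₁α l₂β : Term) →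
   r₁ / α ≡ just r₁α → l₂ / β ≡ just l₂β →
   ∀ (l₃ : Term) → Supertree l₃ l₂β →
   (∀ x → x ∈var l₃ → ¬ (x ∈var l₁)) →
   (α ≡ [] ⊎ β ≡ []) →
   Unifiable r₁α l₃ →
   ∀ (σ : Subst) → MGU σ r₁α l₃ →
   IsVar l₂β ⊎
   (∀ (γ : Pos) (l₃γ : Term) → l₃ / γ ≡ just l₃γ →
      ∀ x → l₂ / (β ++ γ) ≡ just (var x) →
      IsVar (subst σ l₃γ) ⊎ Ground (subst σ l₃γ)))

record BTA : Set where
  field
    nstates : ℕ
    rules   : List (Σ[ f ∈ Sym ] (Vec (Fin nstates) (rank f) × Fin nstates))
    εrules  : List (Fin nstates × Fin nstates)
    finals  : List (Fin nstates)
open BTA public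

BTAOver : RankedAlphabet → BTA → Set
BTAOver Σ' C = ∀ f as a → (f , as , a) ∈ rules C → f ∈ Σ'

data Run (C : BTA) : Term → Fin (nstates C) → Set where
  move : ∀ {f as a} → (f , as , a) ∈ rules C → (ts : Vec Term (rank f)) →
         (∀ i → Run C (lookup ts i) (lookup as i)) → Run C (app f ts) a
  εmove : ∀ {t a a'} → Run C t a → (a , a') ∈ εrules C → Run C t a'

Accepts : RankedAlphabet → BTA → Term → Set
Accepts Σ' C t = GroundOver Σ' t × ∃[ a ] (a ∈ finals C × Run C t a)

EPRF : TRS → Set
EPRF R = ∀ (Σ' : RankedAlphabet) → SignIn R Σ' →
  (L : List Term) → All (GroundOver Σ') L →
  Σ[ C ∈ BTA ] (BTAOver Σ' C ×
    (∀ t → Accepts Σ' C t ⇔ InDescendants R L t))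

{-# OPTIONS --safe #-}

-- Let B consist of the subterms of the terms of L and the ground subterms of right-hand sides,
-- and take as states the finitely many terms of B together with the instances σ(s) of subterms
-- s of right-hand sides with σ into B.  A state f(t₁,…,tₙ) is entered from t₁,…,tₙ by reading f,
-- and ε-transitions are saturated: if a left-hand side l, with its variables at states ρ(x), runs
-- to the state t, then ρ(r) → t is added.  The point is that ρ takes values in B, so that ρ(r) is
-- a state.  Indeed, below the last ε-transition on the way from the root of l to a variable x,
-- the run reads part of an instance of some r₁/α, which is all of r₁ if an ε-transition was taken
-- at all, and GSM forces the subterm of r₁/α met at x to be a variable or ground.  Since every
-- state t stands for a single term, the automaton accepts exactly R*({t}) at t, even when
-- right-hand sides copy variables.
module Submission where

open import Data.Empty using (⊥)
open import Data.Fin using (Fin; zero; suc; toℕ)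
open import Data.Fin.Properties using (toℕ-injective; any?) renaming (_≟_ to _≟ᶠ_)
open import Data.List
  using (List; []; _∷_; _++_; concatMap; map; filter; length; allFin; cartesianProduct)
import Data.List as List
open import Data.List.Extrema.Nat using (max; xs≤max)
open import Data.List.Membership.Propositional using (_∈_; find; lose)
open import Data.List.Membership.Propositional.Properties
  using (∈-map⁺; ∈-map⁻; ∈-concatMap⁺; ∈-concatMap⁻; ∈-filter⁺; ∈-filter⁻; ∈-++⁺ˡ; ∈-++⁺ʳ; ∈-++⁻;
         ∈-allFin; ∈-lookup; ∈-cartesianProduct⁺)
import Data.List.Membership.DecPropositional as DecMembership
open import Data.List.Properties using (length-removeAt′; ∷-injectiveˡ; ∷-injectiveʳ)
open import Data.List.Relation.Unary.All using (All)
import Data.List.Relation.Unary.All as All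
open import Data.List.Relation.Unary.Any using (Any; here; there; index; _─_)
import Data.List.Relation.Unary.Any as Any
open import Data.List.Relation.Unary.Any.Properties using (lookup-index)
open import Data.Maybe using (just; fromMaybe)
open import Data.Maybe.Properties using (just-injective)
open import Data.Nat using (ℕ; zero; suc; _+_; _≤_)
open import Data.Nat.Binary using (ℕᵇ; 2[1+_]; 1+[2_])
import Data.Nat.Binary as ℕᵇ
import Data.Nat.Binary.Properties as ℕᵇₚ
import Data.Nat.Properties as ℕₚ
open import Data.Product using (Σ-syntax; ∃-syntax; _×_; _,_; proj₁; proj₂)
open import Data.Product.Properties using (≡-dec)
open import Data.Sum using (_⊎_; inj₁; inj₂)
open import Data.Vec using (Vec; []; _∷_; lookup; tabulate; _[_]≔_)
import Data.Vec as Vec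
open import Data.Vec.Properties
  using (lookup∘update; lookup∘update′; lookup∘tabulate; lookup-map; tabulate∘lookup; tabulate-cong)
open import Function using (_∘_; id)
open import Function.Bundles using (mk⇔)
open import Relation.Binary.Construct.Closure.ReflexiveTransitive using (Star; ε; _◅_; _◅◅_; gmap)
open import Relation.Binary.PropositionalEquality
  using (_≡_; refl; sym; trans; cong; cong₂; _≢_)
  renaming (subst to transport)
open import Relation.Nullary using (Dec; yes; no; ¬_; contradiction)
open import Relation.Nullary.Decidable using (map′; _×-dec_; _⊎-dec_)

open import Defs renaming (cong to inside)

private variable
  n : ℕ
  s t u v l r : Term
  α β γ : Pos

-- Terms, positions and substitutions

mutual
  _≟ᵗ_ : (s t : Term) → Dec (s ≡ t)
  var x ≟ᵗ var y = map′ (cong var) (λ { refl → refl }) (x ℕₚ.≟ y)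
  var x ≟ᵗ app g ts = no λ ()
  app f ss ≟ᵗ var y = no λ ()
  app f ss ≟ᵗ app g ts with ≡-dec ℕₚ._≟_ ℕₚ._≟_ f g
  ... | yes refl = map′ (cong (app f)) (λ { refl → refl }) (ss ≟ᵛ ts)
  ... | no f≢g   = no λ { refl → f≢g refl }

  _≟ᵛ_ : (ss ts : Vec Term n) → Dec (ss ≡ ts)
  [] ≟ᵛ [] = yes refl
  (s ∷ ss) ≟ᵛ (t ∷ ts) =
    map′ (λ { (refl , refl) → refl }) (λ { refl → refl , refl }) (s ≟ᵗ t ×-dec ss ≟ᵛ ts)

_≟ᵖ_ : (p q : Term × Term) → Dec (p ≡ q)
_≟ᵖ_ = ≡-dec _≟ᵗ_ _≟ᵗ_

open DecMembership _≟ᵗ_ using () renaming (_∈?_ to _∈ᵗ?_)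
open DecMembership _≟ᵖ_ using () renaming (_∈?_ to _∈ᵖ?_)
open DecMembership ℕₚ._≟_ using () renaming (_∈?_ to _∈ⁿ?_)

lookup-ext : {A : Set} {xs ys : Vec A n} → (∀ i → lookup xs i ≡ lookup ys i) → xs ≡ ys
lookup-ext {xs = xs} {ys} eq =
  trans (sym (tabulate∘lookup xs)) (trans (tabulate-cong eq) (tabulate∘lookup ys))

subV-lookup : (ts : Vec Term n) (i : Fin n) (α : Pos) → subV ts (toℕ i) α ≡ lookup ts i / α
subV-lookup (t ∷ ts) zero α = refl
subV-lookup (t ∷ ts) (suc i) α = subV-lookup ts i α

subV⁺ : (ts : Vec Term n) (i : Fin n) → lookup ts i / α ≡ just s → subV ts (toℕ i) α ≡ just s
subV⁺ ts i p = trans (subV-lookup ts i _) p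

subV⁻ : (ts : Vec Term n) (k : ℕ) → subV ts k α ≡ just s →
        ∃[ i ] (k ≡ toℕ i × lookup ts i / α ≡ just s)
subV⁻ (t ∷ ts) zero p = zero , refl , p
subV⁻ (t ∷ ts) (suc k) p with subV⁻ ts k p
... | i , refl , q = suc i , refl , q

mutual
  /-++ : ∀ t α → t / α ≡ just s → t / (α ++ γ) ≡ s / γ
  /-++ t [] refl = refl
  /-++ (app f ts) (i ∷ α) p = subV-++ ts i α p

  subV-++ : (ts : Vec Term n) (i : ℕ) (α : Pos) → subV ts i α ≡ just s → subV ts i (α ++ γ) ≡ s / γ
  subV-++ (t ∷ ts) zero α p = /-++ t α p
  subV-++ (t ∷ ts) (suc i) α p = subV-++ ts i α p

/-child : ∀ {f ts} t α → t / α ≡ just (app f ts) →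
          ∀ i → t / (α ++ toℕ i ∷ []) ≡ just (lookup ts i)
/-child {ts = ts} t α p i = trans (/-++ t α p) (subV-lookup ts i [])

var-/ : ∀ {x y} α → var x / α ≡ just (var y) → x ≡ y
var-/ [] refl = refl

∈var-child : ∀ {f x} (ts : Vec Term (rank f)) i → x ∈var lookup ts i → x ∈var app f ts
∈var-child ts i (α , p) = toℕ i ∷ α , subV⁺ ts i p

∈var-/ : ∀ {x} t α → t / α ≡ just s → x ∈var s → x ∈var t
∈var-/ t α p (γ , q) = α ++ γ , trans (/-++ t α p) q

Linear-child : ∀ {f} {ts : Vec Term (rank f)} → Linear (app f ts) → ∀ i → Linear (lookup ts i)
Linear-child {ts = ts} lin i x α β p q =
  ∷-injectiveʳ (lin x (toℕ i ∷ α) (toℕ i ∷ β) (subV⁺ ts i p) (subV⁺ ts i q))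

lookup-substV : ∀ σ (ts : Vec Term n) i → lookup (substV σ ts) i ≡ subst σ (lookup ts i)
lookup-substV σ (t ∷ ts) zero = refl
lookup-substV σ (t ∷ ts) (suc i) = lookup-substV σ ts i

mutual
  /-subst : ∀ σ t α → t / α ≡ just s → subst σ t / α ≡ just (subst σ s)
  /-subst σ t [] refl = refl
  /-subst σ (app f ts) (i ∷ α) p = subV-substV σ ts i α p

  subV-substV : ∀ σ (ts : Vec Term n) i α → subV ts i α ≡ just s →
                subV (substV σ ts) i α ≡ just (subst σ s)
  subV-substV σ (t ∷ ts) zero α p = /-subst σ t α p
  subV-substV σ (t ∷ ts) (suc i) α p = subV-substV σ ts i α p

mutual
  subst-cong : ∀ {σ τ} t → (∀ x → x ∈var t → σ x ≡ τ x) → subst σ t ≡ subst τ t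
  subst-cong (var x) eq = eq x ([] , refl)
  subst-cong (app f ts) eq = cong (app f) (substV-cong ts λ { x (k , α , p) → eq x (k ∷ α , p) })

  substV-cong : ∀ {σ τ} (ts : Vec Term n) →
                (∀ x → ∃[ k ] ∃[ α ] (subV ts k α ≡ just (var x)) → σ x ≡ τ x) →
                substV σ ts ≡ substV τ ts
  substV-cong [] eq = refl
  substV-cong (t ∷ ts) eq =
    cong₂ _∷_ (subst-cong t λ { x (α , p) → eq x (zero , α , p) })
              (substV-cong ts λ { x (k , α , p) → eq x (suc k , α , p) })

mutual
  subst-var : ∀ t → subst var t ≡ t
  subst-var (var x) = refl
  subst-var (app f ts) = cong (app f) (substV-var ts)

  substV-var : (ts : Vec Term n) → substV var ts ≡ ts
  substV-var [] = refl
  substV-var (t ∷ ts) = cong₂ _∷_ (subst-var t) (substV-var ts)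

subst-fixed : ∀ {σ} t → (∀ x → x ∈var t → σ x ≡ var x) → subst σ t ≡ t
subst-fixed t eq = trans (subst-cong t eq) (subst-var t)

subst-ground : ∀ {σ} t → Ground t → subst σ t ≡ t
subst-ground t g = subst-fixed t λ x x∈t → contradiction x∈t (g x)

-- Listing subterms, variables and substitutions into a finite set

mutual
  subterms : Term → List Term
  subterms (var x) = var x ∷ []
  subterms (app f ts) = app f ts ∷ subtermsV ts

  subtermsV : Vec Term n → List Term
  subtermsV [] = []
  subtermsV (t ∷ ts) = subterms t ++ subtermsV ts

mutual
  ∈-subterms⁺ : ∀ t α → t / α ≡ just s → s ∈ subterms t
  ∈-subterms⁺ (var x) [] refl = here refl
  ∈-subterms⁺ (app f ts) [] refl = here refl
  ∈-subterms⁺ (app f ts) (i ∷ α) p = there (∈-subtermsV⁺ ts i α p)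

  ∈-subtermsV⁺ : ∀ (ts : Vec Term n) i α → subV ts i α ≡ just s → s ∈ subtermsV ts
  ∈-subtermsV⁺ (t ∷ ts) zero α p = ∈-++⁺ˡ (∈-subterms⁺ t α p)
  ∈-subtermsV⁺ (t ∷ ts) (suc i) α p = ∈-++⁺ʳ (subterms t) (∈-subtermsV⁺ ts i α p)

mutual
  ∈-subterms⁻ : ∀ t → s ∈ subterms t → ∃[ α ] (t / α ≡ just s)
  ∈-subterms⁻ (var x) (here refl) = [] , refl
  ∈-subterms⁻ (app f ts) (here refl) = [] , refl
  ∈-subterms⁻ (app f ts) (there s∈) with ∈-subtermsV⁻ ts s∈
  ... | i , α , p = i ∷ α , p

  ∈-subtermsV⁻ : (ts : Vec Term n) → s ∈ subtermsV ts → ∃[ i ] ∃[ α ] (subV ts i α ≡ just s)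
  ∈-subtermsV⁻ (t ∷ ts) s∈ with ∈-++⁻ (subterms t) s∈
  ... | inj₁ s∈t with ∈-subterms⁻ t s∈t
  ...   | α , p = zero , α , p
  ∈-subtermsV⁻ (t ∷ ts) s∈ | inj₂ s∈ts with ∈-subtermsV⁻ ts s∈ts
  ...   | i , α , p = suc i , α , p

varName : Term → List ℕ
varName (var x) = x ∷ []
varName (app f ts) = []

vars : Term → List ℕ
vars t = concatMap varName (subterms t)

∈-vars⁺ : ∀ {x} t → x ∈var t → x ∈ vars t
∈-vars⁺ t (α , p) = ∈-concatMap⁺ varName (lose (∈-subterms⁺ t α p) (here refl))

∈-vars⁻ : ∀ {x} t → x ∈ vars t → x ∈var t
∈-vars⁻ t x∈ with find (∈-concatMap⁻ varName {xs = subterms t} x∈)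
... | var y , s∈t , here refl = ∈-subterms⁻ t s∈t

_∈var?_ : ∀ x t → Dec (x ∈var t)
x ∈var? t = map′ (∈-vars⁻ t) (∈-vars⁺ t) (x ∈ⁿ? vars t)

ground? : ∀ t → Dec (Ground t)
ground? t with vars t in eq
... | [] = yes λ x x∈t → contradiction (transport (x ∈_) eq (∈-vars⁺ t x∈t)) λ ()
... | x ∷ _ = no λ g → g x (∈-vars⁻ t (transport (x ∈_) (sym eq) (here refl)))

var<max : ∀ {x} t → x ∈var t → ¬ (suc (max 0 (vars t)) ≤ x)
var<max t x∈t x≥ =
  ℕₚ.<⇒≱ x≥ (All.lookup (xs≤max 0 (vars t)) (∈-vars⁺ t x∈t))

_[_↦_] : Subst → ℕ → Term → Subst
(σ [ x ↦ t ]) y with y ℕₚ.≟ x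
... | yes _ = t
... | no _ = σ y

assignments : List ℕ → List Term → List Subst
assignments [] B = var ∷ []
assignments (x ∷ xs) B = concatMap (λ b → map _[ x ↦ b ] (assignments xs B)) B

-- Substitutions are functions on all variables, so a finite list covers them only up to agreement
-- on `xs`. Repetitions in `xs` are harmless: the outer update overrides the inner one with the same
-- value `ρ x`.
assignments-complete : ∀ xs {B} (ρ : Subst) → (∀ x → x ∈ xs → ρ x ∈ B) →
  ∃[ σ ] (σ ∈ assignments xs B × (∀ x → x ∈ xs → ρ x ≡ σ x))
assignments-complete [] ρ ρ∈B = var , here refl , λ _ ()
assignments-complete (x ∷ xs) ρ ρ∈B
  with assignments-complete xs ρ (λ y y∈ → ρ∈B y (there y∈))
... | σ , σ∈ , eq =
  σ [ x ↦ ρ x ] , ∈-concatMap⁺ _ (lose (ρ∈B x (here refl)) (∈-map⁺ _ σ∈)) , agree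
  where
  agree : ∀ y → y ∈ x ∷ xs → ρ y ≡ (σ [ x ↦ ρ x ]) y
  agree y y∈ with y ℕₚ.≟ x | y∈
  ... | yes refl | _ = refl
  ... | no y≢x | here refl = contradiction refl y≢x
  ... | no _ | there y∈xs = eq y y∈xs

assignments-sound : ∀ xs {B σ} → σ ∈ assignments xs B → ∀ x → x ∈ xs → σ x ∈ B
assignments-sound (x ∷ xs) {B} σ∈ y y∈ with find (∈-concatMap⁻ _ {xs = B} σ∈)
... | b , b∈B , σ∈′ with ∈-map⁻ _ σ∈′
...   | τ , τ∈ , refl with y ℕₚ.≟ x | y∈
...     | yes _ | _ = b∈B
...     | no y≢x | here refl = contradiction refl y≢x
...     | no _ | there y∈xs = assignments-sound xs τ∈ y y∈xs

-- Matching of linear patterns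

-- Different occurrences of one variable may be matched with different terms; for a linear left term
-- `matcher` turns the relation into a substitution.
data _≼_ : Term → Term → Set where
  var : ∀ {x t} → var x ≼ t
  app : ∀ {f ls ts} → (∀ i → lookup ls i ≼ lookup ts i) → app f ls ≼ app f ts

≼-/ : l ≼ t → ∀ α → l / α ≡ just s → ∃[ u ] (t / α ≡ just u)
≼-/ _ [] p = _ , refl
≼-/ (app {ls = ls} {ts} m) (k ∷ α) p with subV⁻ ls k p
... | i , refl , q with ≼-/ (m i) α q
...   | u , q′ = u , subV⁺ ts i q′

≼-subst : ∀ {θ} → l ≼ t → (∀ α x → l / α ≡ just (var x) → t / α ≡ just (θ x)) → subst θ l ≡ t
≼-subst var fit = sym (just-injective (fit [] _ refl))
≼-subst {θ = θ} (app {f} {ls} {ts} m) fit =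
  cong (app f) (lookup-ext λ i → trans (lookup-substV θ ls i) (≼-subst (m i) λ α x p →
    trans (sym (subV-lookup ts i α)) (fit (toℕ i ∷ α) x (subV⁺ ls i p))))

-- By linearity `x` has a single position in `l`, and `θ x` is read off `t` there. That position
-- exists in `t` by `≼-/`, so the default in `fromMaybe` is never taken. Variables outside `l` are
-- fixed so that `θ` can serve as a unifier in `≼⇒MGU`.
matcher : l ≼ t → Linear l → ∃[ θ ] (subst θ l ≡ t × (∀ x → ¬ (x ∈var l) → θ x ≡ var x))
matcher {l} {t} m lin = θ , ≼-subst m fit , fixed
  where
  θ : Subst
  θ x with x ∈var? l
  ... | yes (α , _) = fromMaybe (var x) (t / α)
  ... | no _ = var x
  fit : ∀ α x → l / α ≡ just (var x) → t / α ≡ just (θ x)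
  fit α x p with x ∈var? l
  ... | no x∉ = contradiction (α , p) x∉
  ... | yes (β , q) with lin x α β p q
  ...   | refl with ≼-/ m α p
  ...     | u , e rewrite e = refl
  fixed : ∀ x → ¬ (x ∈var l) → θ x ≡ var x
  fixed x x∉ with x ∈var? l
  ... | yes x∈ = contradiction x∈ x∉
  ... | no _ = refl

≼⇒Supertree : l ≼ t → Linear l → Supertree l t
≼⇒Supertree m lin with matcher m lin
... | θ , eq , _ = lin , θ , sym eq

-- The matcher moves only variables of `l`, so it fixes `t` and unifies. Any unifier `θ` factors
-- through it by `θ` itself: comparing `θ(l)` with `θ(t)` at the position of `x` in `l` gives
-- `θ x = θ(μ x)`.
≼⇒MGU : l ≼ t → Linear l → (∀ x → x ∈var l → ¬ (x ∈var t)) → ∃[ μ ] (MGU μ t l × subst μ l ≡ t)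
≼⇒MGU {l} {t} m lin disjoint with matcher m lin
... | μ , eq , fixed = μ , (unifies , most-general) , eq
  where
  unifies : subst μ t ≡ subst μ l
  unifies = trans (subst-fixed t λ x x∈t → fixed x λ x∈l → disjoint x x∈l x∈t) (sym eq)
  most-general : ∀ θ → Unifier θ t l → ∃[ ρ ] (∀ x → θ x ≡ subst ρ (μ x))
  most-general θ unif = θ , agree
    where
    agree : ∀ x → θ x ≡ subst θ (μ x)
    agree x with x ∈var? l
    ... | no x∉ rewrite fixed x x∉ = refl
    ... | yes (α , p) = just-injective (trans (sym (/-subst θ l α p))
        (trans (cong (_/ α) (sym unif)) (/-subst θ t α
          (trans (cong (_/ α) (sym eq)) (/-subst μ l α p)))))

-- Positions must become variable names, that is numbers, injectively. An index `i` is written as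
-- `i` digits `2[1+_]` closed by one digit `1+[2_]`, so codes can be decoded digit by digit.
encode : Pos → ℕᵇ
encode = List.foldr step ℕᵇ.zero
  where
  step : ℕ → ℕᵇ → ℕᵇ
  step zero b = 1+[2 b ]
  step (suc i) b = 2[1+ step i b ]

encode-injective : ∀ α β → encode α ≡ encode β → α ≡ β
encode-injective [] [] eq = refl
encode-injective [] (zero ∷ β) ()
encode-injective [] (suc j ∷ β) ()
encode-injective (zero ∷ α) [] ()
encode-injective (suc i ∷ α) [] ()
encode-injective (zero ∷ α) (zero ∷ β) eq = cong (0 ∷_) (encode-injective α β (ℕᵇₚ.1+[2_]-injective eq))
encode-injective (zero ∷ α) (suc j ∷ β) ()
encode-injective (suc i ∷ α) (zero ∷ β) ()
encode-injective (suc i ∷ α) (suc j ∷ β) eq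
  with encode-injective (i ∷ α) (j ∷ β) (ℕᵇₚ.2[1+_]-injective eq)
... | refl = refl

-- Finite fixpoints

∈-─⁻ : {A : Set} {P : A → Set} {a : A} (xs : List A) (p : Any P xs) → a ∈ (xs ─ p) → a ∈ xs
∈-─⁻ (x ∷ xs) (here _) a∈ = there a∈
∈-─⁻ (x ∷ xs@(_ ∷ _)) (there p) (here refl) = here refl
∈-─⁻ (x ∷ xs@(_ ∷ _)) (there p) (there a∈) = there (∈-─⁻ xs p a∈)

∈-─⁺ : {A : Set} {P : A → Set} {a : A} (xs : List A) (p : Any P xs) → a ∈ xs →
       a ≡ List.lookup xs (index p) ⊎ a ∈ (xs ─ p)
∈-─⁺ (x ∷ xs) (here _) (here eq) = inj₁ eq
∈-─⁺ (x ∷ xs) (here _) (there a∈) = inj₂ a∈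
∈-─⁺ (x ∷ xs@(_ ∷ _)) (there p) (here eq) = inj₂ (here eq)
∈-─⁺ (x ∷ xs@(_ ∷ _)) (there p) (there a∈) with ∈-─⁺ xs p a∈
... | inj₁ eq = inj₁ eq
... | inj₂ a∈′ = inj₂ (there a∈′)

-- `P E a` is read as: `a` follows from `E` in one step. Each round of `go` moves one such element
-- from `rest` to `E`, so `rest` shrinks; once it contains none, `E` is closed. `Good` is an
-- invariant of the rounds.
module Saturation {A : Set} (U : List A) (P : List A → A → Set) (P? : ∀ E a → Dec (P E a))
  (Good : A → Set) (sound : ∀ {E a} → a ∈ U → (∀ {b} → b ∈ E → Good b) → P E a → Good a) where

  private
    go : ∀ n E rest → length rest ≡ n → (∀ {b} → b ∈ E → Good b) →
         (∀ {a} → a ∈ rest → a ∈ U) → (∀ {a} → a ∈ U → a ∈ E ⊎ a ∈ rest) →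
         ∃[ E′ ] ((∀ {b} → b ∈ E′ → Good b) × (∀ {a} → a ∈ U → P E′ a → a ∈ E′))
    go n E rest len good rest⊆U split with Any.any? (P? E) rest
    ... | no none = E , good , closed
      where
      closed : ∀ {a} → a ∈ U → P E a → a ∈ E
      closed a∈U pa with split a∈U
      ... | inj₁ a∈E = a∈E
      ... | inj₂ a∈rest = contradiction (lose a∈rest pa) none
    go zero E [] len good rest⊆U split | yes ()
    go (suc n) E rest len good rest⊆U split | yes p =
      go n (a₀ ∷ E) (rest ─ p)
        (ℕₚ.suc-injective (trans (sym (length-removeAt′ rest (index p))) len))
        (λ { (here refl) → sound (rest⊆U (∈-lookup (index p))) good (lookup-index p)
           ; (there b∈E) → good b∈E })
        (rest⊆U ∘ ∈-─⁻ rest p) split′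
      where
      a₀ = List.lookup rest (index p)
      split′ : ∀ {a} → a ∈ U → a ∈ a₀ ∷ E ⊎ a ∈ (rest ─ p)
      split′ a∈U with split a∈U
      ... | inj₁ a∈E = inj₁ (there a∈E)
      ... | inj₂ a∈rest with ∈-─⁺ rest p a∈rest
      ...   | inj₁ eq = inj₁ (here eq)
      ...   | inj₂ a∈ = inj₂ a∈

  saturate : ∃[ E ] ((∀ {b} → b ∈ E → Good b) × (∀ {a} → a ∈ U → P E a → a ∈ E))
  saturate = go _ [] U refl (λ ()) id inj₂

-- Rewriting under function symbols

-- Detached from `app f`, which ties the length to `rank f`, the argument vector admits induction.
data StepV (R : TRS) {n} (ts : Vec Term n) : Vec Term n → Set where
  stepAt : ∀ i → Step R (lookup ts i) u → StepV R ts (ts [ i ]≔ u)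

StepsV : ∀ {R} (ts us : Vec Term n) → (∀ i → Steps R (lookup ts i) (lookup us i)) →
         Star (StepV R) ts us
StepsV [] [] steps = ε
StepsV (t ∷ ts) (u ∷ us) steps =
  gmap (_∷ ts) (stepAt zero) (steps zero) ◅◅
  gmap (u ∷_) (λ { (stepAt i s) → stepAt (suc i) s }) (StepsV ts us (steps ∘ suc))

Steps-app : ∀ {R} f (ts us : Vec Term (rank f)) → (∀ i → Steps R (lookup ts i) (lookup us i)) →
            Steps R (app f ts) (app f us)
Steps-app f ts us steps = gmap (app f) (λ { (stepAt i s) → inside f _ i s }) (StepsV ts us steps)

-- Runs of patterns

-- A pair (s , t) in E is read as an ε-transition from the state s to the state t.  States are
-- terms, app f ts being reached from ts by reading f, and Q x t says that a leaf x of the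
-- pattern may be at state t.
mutual
  data Match (E : List (Term × Term)) (Q : ℕ → Term → Set) : Term → Term → Set where
    leaf   : ∀ {x t} → Q x t → Match E Q (var x) t
    direct : Direct E Q l t → Match E Q l t
    via    : (s , t) ∈ E → Direct E Q l s → Match E Q l t

  data Direct (E : List (Term × Term)) (Q : ℕ → Term → Set) : Term → Term → Set where
    node : ∀ {f ls ts} → (∀ i → Match E Q (lookup ls i) (lookup ts i)) →
           Direct E Q (app f ls) (app f ts)

private variable
  E : List (Term × Term)
  Q Q′ : ℕ → Term → Set

mutual
  Match-map : (∀ x c → x ∈var l → Q x c → Q′ x c) → Match E Q l t → Match E Q′ l t
  Match-map g (leaf q) = leaf (g _ _ ([] , refl) q)
  Match-map g (direct d) = direct (Direct-map g d)
  Match-map g (via e d) = via e (Direct-map g d)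

  Direct-map : (∀ x c → x ∈var l → Q x c → Q′ x c) → Direct E Q l t → Direct E Q′ l t
  Direct-map g (node {ls = ls} ms) = node λ i → Match-map (λ x c x∈ → g x c (∈var-child ls i x∈)) (ms i)

module _ {E : List (Term × Term)} {Q : ℕ → Term → Set} (Q? : ∀ x t → Dec (Q x t)) where
  mutual
    match? : ∀ l t → Dec (Match E Q l t)
    match? (var x) t = map′ leaf (λ { (leaf q) → q ; (direct ()) ; (via _ ()) }) (Q? x t)
    match? l@(app _ _) t =
      map′ (λ { (inj₁ d) → direct d ; (inj₂ any) → from-any any })
           (λ { (direct d) → inj₁ d ; (via st∈E d) → inj₂ (lose st∈E (refl , d)) })
           (direct? l t ⊎-dec Any.any? (λ (s , u) → u ≟ᵗ t ×-dec direct? l s) E)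
      where
      from-any : Any (λ (s , u) → u ≡ t × Direct E Q l s) E → Match E Q l t
      from-any any with find any
      ... | _ , st∈E , refl , d = via st∈E d

    direct? : ∀ l t → Dec (Direct E Q l t)
    direct? (var x) t = no λ ()
    direct? (app f ls) (var y) = no λ ()
    direct? (app f ls) (app g ts) with ≡-dec ℕₚ._≟_ ℕₚ._≟_ f g
    ... | no f≢g = no λ { (node _) → f≢g refl }
    ... | yes refl = map′ node (λ { (node ms) → ms }) (matchV? ls ts)

    matchV? : (ls ts : Vec Term n) → Dec (∀ i → Match E Q (lookup ls i) (lookup ts i))
    matchV? [] [] = yes λ ()
    matchV? (l ∷ ls) (t ∷ ts) =
      map′ (λ { (m , ms) zero → m ; (m , ms) (suc i) → ms i })
           (λ ms → ms zero , ms ∘ suc) (match? l t ×-dec matchV? ls ts)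

mutual
  -- The run is cut at the variables of `l`. Occurrences of one variable may still stand at
  -- different states; for linear `l`, `Match-choice` makes the state a function of the variable.
  Match-unsubst : ∀ {τ} l → Match E Q (subst τ l) t → Match E (λ x → Match E Q (τ x)) l t
  Match-unsubst (var x) m = leaf m
  Match-unsubst (app f ls) (direct d) = direct (Direct-unsubst f ls d)
  Match-unsubst (app f ls) (via e d) = via e (Direct-unsubst f ls d)

  Direct-unsubst : ∀ {τ} f ls → Direct E Q (app f (substV τ ls)) t →
                   Direct E (λ x → Match E Q (τ x)) (app f ls) t
  Direct-unsubst f ls (node {ts = ts} ms) = node (MatchV-unsubst ls ts ms)

  MatchV-unsubst : ∀ {τ} (ls ts : Vec Term n) → (∀ i → Match E Q (lookup (substV τ ls) i) (lookup ts i)) →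
                   ∀ i → Match E (λ x → Match E Q (τ x)) (lookup ls i) (lookup ts i)
  MatchV-unsubst (l ∷ ls) (t ∷ ts) ms zero = Match-unsubst l (ms zero)
  MatchV-unsubst (l ∷ ls) (t ∷ ts) ms (suc i) = MatchV-unsubst ls ts (ms ∘ suc) i

mutual
  -- Serves right-hand sides: `ρ` gives one state per variable, so all copies of `τ x` run to the
  -- same state and `s` may be non-linear.
  Match-subst : ∀ {τ ρ} s → (∀ x → x ∈var s → Match E Q (τ x) (ρ x)) → Match E Q (subst τ s) (subst ρ s)
  Match-subst (var x) ms = ms x ([] , refl)
  Match-subst (app f ss) ms =
    direct (node (MatchV-subst ss λ { x (k , α , p) → ms x (k ∷ α , p) }))

  MatchV-subst : ∀ {τ ρ} (ss : Vec Term n) →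
                 (∀ x → ∃[ k ] ∃[ α ] (subV ss k α ≡ just (var x)) → Match E Q (τ x) (ρ x)) →
                 ∀ i → Match E Q (lookup (substV τ ss) i) (lookup (substV ρ ss) i)
  MatchV-subst (s ∷ ss) ms zero = Match-subst s λ { x (α , p) → ms x (zero , α , p) }
  MatchV-subst (s ∷ ss) ms (suc i) = MatchV-subst ss (λ { x (k , α , p) → ms x (suc k , α , p) }) i

-- In a linear pattern every variable has a single leaf, so its state is a function of the variable.
mutual
  Match-choice : Linear l → Match E Q l t →
    Σ[ ρ ∈ Subst ] ((∀ x → x ∈var l → Q x (ρ x)) × Match E (λ x c → c ≡ ρ x) l t)
  Match-choice {Q = Q} lin (leaf {t = t} q) =
    (λ _ → t) , (λ { x (α , p) → transport (λ y → Q y t) (var-/ α p) q }) , leaf refl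
  Match-choice lin (direct d) with Direct-choice lin d
  ... | ρ , qs , d′ = ρ , qs , direct d′
  Match-choice lin (via e d) with Direct-choice lin d
  ... | ρ , qs , d′ = ρ , qs , via e d′

  Direct-choice : Linear l → Direct E Q l t →
    Σ[ ρ ∈ Subst ] ((∀ x → x ∈var l → Q x (ρ x)) × Direct E (λ x c → c ≡ ρ x) l t)
  Direct-choice {E = E} {Q} lin (node {f} {ls} {ts} ms) = ρ , qs , node ms′
    where
    choice : ∀ i → Σ[ ρ ∈ Subst ] ((∀ x → x ∈var lookup ls i → Q x (ρ x)) ×
                           Match E (λ x c → c ≡ ρ x) (lookup ls i) (lookup ts i))
    choice i = Match-choice (Linear-child lin i) (ms i)
    -- By linearity at most one argument contains `x`, so its choice is the only candidate; outside
    -- the pattern the value is arbitrary.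
    ρ : Subst
    ρ x with any? (λ i → x ∈var? lookup ls i)
    ... | yes (i , _) = proj₁ (choice i) x
    ... | no _ = var x
    agree : ∀ i x → x ∈var lookup ls i → proj₁ (choice i) x ≡ ρ x
    agree i x (α , p) with any? (λ i → x ∈var? lookup ls i)
    ... | no none = contradiction (i , α , p) none
    ... | yes (j , β , q)
      with toℕ-injective (∷-injectiveˡ (lin x (toℕ i ∷ α) (toℕ j ∷ β) (subV⁺ ls i p) (subV⁺ ls j q)))
    ...   | refl = refl
    qs : ∀ x → x ∈var app f ls → Q x (ρ x)
    qs x ([] , ())
    qs x (k ∷ α , p) with subV⁻ ls k p
    ... | i , _ , q = transport (Q x) (agree i x (α , q)) (proj₁ (proj₂ (choice i)) x (α , q))
    ms′ : ∀ i → Match E (λ x c → c ≡ ρ x) (lookup ls i) (lookup ts i)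
    ms′ i = Match-map (λ x c x∈ eq → trans eq (agree i x x∈)) (proj₂ (proj₂ (choice i)))

mutual
  -- A state is itself a term, so a run read from the root down is a derivation from `t`: an
  -- ε-transition is followed backwards by rewriting, and a leaf at `c` is rewritten to `τ x`.
  Match⇒Steps : ∀ {R τ} → (∀ {s t} → (s , t) ∈ E → Steps R t s) → (∀ x c → Q x c → Steps R c (τ x)) →
                Match E Q l t → Steps R t (subst τ l)
  Match⇒Steps ε-sound leaf-sound (leaf q) = leaf-sound _ _ q
  Match⇒Steps ε-sound leaf-sound (direct d) = Direct⇒Steps ε-sound leaf-sound d
  Match⇒Steps ε-sound leaf-sound (via e d) = ε-sound e ◅◅ Direct⇒Steps ε-sound leaf-sound d

  Direct⇒Steps : ∀ {R τ} → (∀ {s t} → (s , t) ∈ E → Steps R t s) → (∀ x c → Q x c → Steps R c (τ x)) →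
                 Direct E Q l t → Steps R t (subst τ l)
  Direct⇒Steps {R = R} {τ} ε-sound leaf-sound (node {f} {ls} {ts} ms) =
    Steps-app f ts (substV τ ls) λ i →
      transport (Steps R _) (sym (lookup-substV τ ls i)) (Match⇒Steps ε-sound leaf-sound (ms i))

-- Overlaps of a right-hand side with a left-hand side

-- The part of the pattern l that is read without ε-transitions and inside r; it is the term l₃
-- of the definition of GSM.  Its variables are named after their positions.
mutual
  cut : ∀ {σ} → (Pos → ℕ) → Match E Q l t → ∀ r → t ≡ subst σ r → Term
  cut name (direct d) r eq = cutᵈ name d r eq
  cut name (leaf _) r eq = var (name [])
  cut name (via _ _) r eq = var (name [])

  cutᵈ : ∀ {σ} → (Pos → ℕ) → Direct E Q l t → ∀ r → t ≡ subst σ r → Term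
  cutᵈ name (node ms) (var x) eq = var (name [])
  cutᵈ {σ = σ} name (node ms) (app g rs) refl = app g (tabulate λ i →
    cut (name ∘ (toℕ i ∷_)) (ms i) (lookup rs i) (lookup-substV σ rs i))

subV-tabulate⁻ : ∀ (g : Fin n → Term) k → subV (tabulate g) k α ≡ just s →
                ∃[ i ] (k ≡ toℕ i × g i / α ≡ just s)
subV-tabulate⁻ {α = α} g k p with subV⁻ (tabulate g) k p
... | i , eq , q = i , eq , trans (cong (_/ α) (sym (lookup∘tabulate g i))) q

subV-tabulate⁺ : ∀ (g : Fin n → Term) i → g i / α ≡ just s → subV (tabulate g) (toℕ i) α ≡ just s
subV-tabulate⁺ {α = α} g i p = subV⁺ (tabulate g) i (trans (cong (_/ α) (lookup∘tabulate g i)) p)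

mutual
  cut-names : ∀ {σ x} name (m : Match E Q l t) r (eq : t ≡ subst σ r) α →
              cut name m r eq / α ≡ just (var x) → x ≡ name α
  cut-names name (direct d) r eq α p = cutᵈ-names name d r eq α p
  cut-names name (leaf _) r eq [] refl = refl
  cut-names name (via _ _) r eq [] refl = refl

  cutᵈ-names : ∀ {σ x} name (d : Direct E Q l t) r (eq : t ≡ subst σ r) α →
              cutᵈ name d r eq / α ≡ just (var x) → x ≡ name α
  cutᵈ-names name (node ms) (var x) eq [] refl = refl
  cutᵈ-names {σ = σ} name (node ms) (app g rs) refl (k ∷ α) p
    with subV-tabulate⁻ (λ i → cut (name ∘ (toℕ i ∷_)) (ms i) (lookup rs i) (lookup-substV σ rs i)) k p
  ... | i , refl , q = cut-names _ (ms i) (lookup rs i) (lookup-substV σ rs i) α q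

mutual
  -- With distinct names this makes the cut a supertree of the pattern.
  cut≼pattern : ∀ {σ} name (m : Match E Q l t) r (eq : t ≡ subst σ r) → cut name m r eq ≼ l
  cut≼pattern name (direct d) r eq = cutᵈ≼pattern name d r eq
  cut≼pattern name (leaf _) r eq = var
  cut≼pattern name (via _ _) r eq = var

  cutᵈ≼pattern : ∀ {σ} name (d : Direct E Q l t) r (eq : t ≡ subst σ r) → cutᵈ name d r eq ≼ l
  cutᵈ≼pattern name (node ms) (var x) eq = var
  cutᵈ≼pattern name (node ms) (app g rs) refl = app λ i →
    transport (_≼ _) (sym (lookup∘tabulate _ i)) (cut≼pattern _ (ms i) (lookup rs i) _)

mutual
  -- With distinct names this makes `r` an instance of the cut, so a most general unifier can leave
  -- `r` unchanged.
  cut≼rhs : ∀ {σ} name (m : Match E Q l t) r (eq : t ≡ subst σ r) → cut name m r eq ≼ r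
  cut≼rhs name (direct d) r eq = cutᵈ≼rhs name d r eq
  cut≼rhs name (leaf _) r eq = var
  cut≼rhs name (via _ _) r eq = var

  cutᵈ≼rhs : ∀ {σ} name (d : Direct E Q l t) r (eq : t ≡ subst σ r) → cutᵈ name d r eq ≼ r
  cutᵈ≼rhs name (node ms) (var x) eq = var
  cutᵈ≼rhs name (node ms) (app g rs) refl = app λ i →
    transport (_≼ _) (sym (lookup∘tabulate _ i)) (cut≼rhs _ (ms i) (lookup rs i) _)

module _ {R : TRS} (isTRS : IsTRS R) (leftLinear : LeftLinear R) (gsm : GSM R) where

  -- The condition on unifiers in GSM only matters for r₁/α an instance of l₃, when matching
  -- l₃ against r₁/α gives a most general unifier.
  overlap-leaf : ∀ {l₁ r₁ l₂ r₂ σ} → (l₁ , r₁) ∈ R → (l₂ , r₂) ∈ R →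
    ∀ α β → r₁ / α ≡ just r → l₂ / β ≡ just l → α ≡ [] ⊎ β ≡ [] →
    (d : Direct E Q l t) (eq : t ≡ subst σ r) →
    ∃[ name ] (∀ γ {x r′} → l / γ ≡ just (var x) → γ ∈POS cutᵈ name d r eq →
               r / γ ≡ just r′ → IsVar r′ ⊎ Ground r′)
  overlap-leaf {r} {l} {l₁ = l₁} {r₁} {l₂} rule₁ rule₂ α β r₁/α l₂/β αβ d eq = name , cond
    where
    -- Names start above all variables of `l₁`. They then avoid `r₁/α` as well, since
    -- `var(r₁) ⊆ var(l₁)`, and `≼⇒MGU` applies.
    bound = suc (max 0 (vars l₁))
    name : Pos → ℕ
    name γ = bound + ℕᵇ.toℕ (encode γ)
    l₃ = cutᵈ name d r eq
    name-injective : ∀ γ δ → name γ ≡ name δ → γ ≡ δ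
    name-injective γ δ = encode-injective γ δ ∘ ℕᵇₚ.toℕ-injective ∘ ℕₚ.+-cancelˡ-≡ bound _ _
    linear : Linear l₃
    linear x γ δ p q = name-injective γ δ
      (trans (sym (cutᵈ-names name d r eq γ p)) (cutᵈ-names name d r eq δ q))
    fresh : ∀ x → x ∈var l₃ → ¬ (x ∈var l₁)
    fresh x (γ , p) x∈l₁ = var<max l₁ x∈l₁
      (transport (bound ≤_) (sym (cutᵈ-names name d r eq γ p)) (ℕₚ.m≤m+n bound _))
    mgu : ∃[ μ ] (MGU μ r l₃ × subst μ l₃ ≡ r)
    mgu = ≼⇒MGU (cutᵈ≼rhs name d r eq) linear λ x x∈l₃ x∈r →
      fresh x x∈l₃ (isTRS _ _ rule₁ x (∈var-/ r₁ α r₁/α x∈r))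
    μ = proj₁ mgu
    cond : ∀ γ {x r′} → l / γ ≡ just (var x) → γ ∈POS l₃ → r / γ ≡ just r′ → IsVar r′ ⊎ Ground r′
    cond γ l/γ (l₃γ , l₃/γ) r/γ
      with proj₂ gsm _ _ _ _ rule₁ rule₂ α β r l r₁/α l₂/β l₃
             (≼⇒Supertree (cutᵈ≼pattern name d r eq) linear) fresh αβ
             (μ , proj₁ (proj₁ (proj₂ mgu))) μ (proj₁ (proj₂ mgu))
    -- Alternative (a) is impossible: a `Direct` run reads a function symbol at the root of `l`.
    ... | inj₁ l-var = contradiction l-var (λ (_ , e) → not-var d e)
      where
      not-var : ∀ {E Q l t x} → Direct E Q l t → l ≢ var x
      not-var (node _) ()
    -- As `μ` sends `l₃` to `r`, the term that (b) speaks of is `r/γ`.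
    ... | inj₂ b = transport (λ s → IsVar s ⊎ Ground s)
      (just-injective (trans (sym (/-subst μ l₃ γ l₃/γ)) (trans (cong (_/ γ) (proj₂ (proj₂ mgu))) r/γ)))
      (b γ l₃γ l₃/γ _ (trans (/-++ l₂ β l₂/β) l/γ))

  -- The terms that serve as states

  module Construction (Σ' : RankedAlphabet) (sign : SignIn R Σ')
                      (L : List Term) (L-over : All (GroundOver Σ') L) where

    rhsSubterms : List Term
    rhsSubterms = concatMap (subterms ∘ proj₂) R

    SubtermOfRhs : Term → Set
    SubtermOfRhs s = ∃[ l ] ∃[ r ] ((l , r) ∈ R × ∃[ α ] (r / α ≡ just s))

    rhsSubterms⁺ : SubtermOfRhs s → s ∈ rhsSubterms
    rhsSubterms⁺ (l , r , rule , α , p) = ∈-concatMap⁺ _ (lose rule (∈-subterms⁺ r α p))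

    rhsSubterms⁻ : s ∈ rhsSubterms → SubtermOfRhs s
    rhsSubterms⁻ s∈ with find (∈-concatMap⁻ (subterms ∘ proj₂) {xs = R} s∈)
    ... | (l , r) , rule , s∈r = l , r , rule , ∈-subterms⁻ r s∈r

    SubtermOfRhs-child : ∀ {f ts} → SubtermOfRhs (app f ts) → ∀ i → SubtermOfRhs (lookup ts i)
    SubtermOfRhs-child (l , r , rule , α , p) i = l , r , rule , α ++ toℕ i ∷ [] , /-child r α p i

    -- By GSM, the variables of a rule are only ever instantiated by these terms.
    base : List Term
    base = concatMap subterms L ++ filter ground? rhsSubterms

    base⁺ : Ground s → SubtermOfRhs s → s ∈ base
    base⁺ g sub = ∈-++⁺ʳ (concatMap subterms L) (∈-filter⁺ ground? (rhsSubterms⁺ sub) g)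

    base⁻ : s ∈ base → (∃[ q ] (q ∈ L × ∃[ α ] (q / α ≡ just s))) ⊎ (Ground s × SubtermOfRhs s)
    base⁻ s∈ with ∈-++⁻ (concatMap subterms L) s∈
    ... | inj₁ s∈L with find (∈-concatMap⁻ subterms {xs = L} s∈L)
    ...   | q , q∈L , s∈q = inj₁ (q , q∈L , ∈-subterms⁻ q s∈q)
    base⁻ s∈ | inj₂ s∈rhs with ∈-filter⁻ ground? s∈rhs
    ...   | s∈′ , g = inj₂ (g , rhsSubterms⁻ s∈′)

    L⊆base : s ∈ L → s ∈ base
    L⊆base {s} s∈L = ∈-++⁺ˡ (∈-concatMap⁺ subterms (lose s∈L (∈-subterms⁺ s [] refl)))

    base-child : ∀ {f ts} → app f ts ∈ base → ∀ i → lookup ts i ∈ base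
    base-child {f} {ts} s∈ i with base⁻ s∈
    ... | inj₁ (q , q∈L , α , p) =
      ∈-++⁺ˡ (∈-concatMap⁺ subterms (lose q∈L (∈-subterms⁺ q (α ++ toℕ i ∷ []) (/-child q α p i))))
    ... | inj₂ (g , sub) =
      base⁺ (λ x x∈ → g x (∈var-child ts i x∈)) (SubtermOfRhs-child sub i)

    IntoBase : Subst → Term → Set
    IntoBase σ s = ∀ x → x ∈var s → σ x ∈ base

    Instance : Term → Set
    Instance t = ∃[ s ] (SubtermOfRhs s × Σ[ σ ∈ Subst ] (IntoBase σ s × t ≡ subst σ s))

    states : List Term
    states = base ++ concatMap (λ s → map (λ σ → subst σ s) (assignments (vars s) base)) rhsSubterms

    base⊆states : s ∈ base → s ∈ states
    base⊆states = ∈-++⁺ˡ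

    states⁺ : Instance s → s ∈ states
    states⁺ (s , sub , σ , σ∈base , refl)
      with assignments-complete (vars s) σ (λ x x∈ → σ∈base x (∈-vars⁻ s x∈))
    ... | τ , τ∈ , eq = ∈-++⁺ʳ base (∈-concatMap⁺ _ (lose (rhsSubterms⁺ sub)
      (transport (_∈ _) (sym (subst-cong s λ x x∈ → eq x (∈-vars⁺ s x∈))) (∈-map⁺ _ τ∈))))

    states⁻ : s ∈ states → s ∈ base ⊎ Instance s
    states⁻ t∈ with ∈-++⁻ base t∈
    ... | inj₁ t∈base = inj₁ t∈base
    ... | inj₂ t∈inst with find (∈-concatMap⁻ _ {xs = rhsSubterms} t∈inst)
    ...   | s , s∈ , t∈s with ∈-map⁻ _ t∈s
    ...     | σ , σ∈ , eq = inj₂ (s , rhsSubterms⁻ s∈ , σ ,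
              (λ x x∈ → assignments-sound (vars s) σ∈ x (∈-vars⁺ s x∈)) , eq)

    -- An instance of a variable lies in `base`, which is closed under arguments; any other instance
    -- passes to the arguments of the instantiated term.
    states-child : ∀ {f ts} → app f ts ∈ states → ∀ i → lookup ts i ∈ states
    states-child s∈ i with states⁻ s∈
    ... | inj₁ s∈base = base⊆states (base-child s∈base i)
    ... | inj₂ (var x , sub , σ , σ∈base , eq) =
      base⊆states (base-child (transport (_∈ base) (sym eq) (σ∈base x ([] , refl))) i)
    ... | inj₂ (app f ss , sub , σ , σ∈base , refl) =
      states⁺ (lookup ss i , SubtermOfRhs-child sub i , σ ,
        (λ x x∈ → σ∈base x (∈var-child ss i x∈)) , lookup-substV σ ss i)

    rhs-over : ∀ {f ts} → SubtermOfRhs (app f ts) → f ∈ Σ'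
    rhs-over (l , r , rule , α , p) = proj₂ (sign l r rule) _ (α , _ , p)

    base-over : ∀ {f ts} → app f ts ∈ base → f ∈ Σ'
    base-over s∈ with base⁻ s∈
    ... | inj₁ (q , q∈L , α , p) = proj₂ (All.lookup L-over q∈L) _ (α , _ , p)
    ... | inj₂ (_ , sub) = rhs-over sub

    states-over : ∀ {f ts} → app f ts ∈ states → f ∈ Σ'
    states-over s∈ with states⁻ s∈
    ... | inj₁ s∈base = base-over s∈base
    ... | inj₂ (var x , sub , σ , σ∈base , eq) =
      base-over (transport (_∈ base) (sym eq) (σ∈base x ([] , refl)))
    ... | inj₂ (app f ss , sub , σ , σ∈base , refl) = rhs-over sub

    -- Saturated ε-transitions

    RhsInstance : Term → Set
    RhsInstance t = ∃[ l ] ∃[ r ] ((l , r) ∈ R × Σ[ σ ∈ Subst ] (IntoBase σ r × t ≡ subst σ r))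

    RhsInstance⇒states : RhsInstance s → s ∈ states
    RhsInstance⇒states (l , r , rule , σ , σ∈base , eq) =
      states⁺ (r , (l , r , rule , [] , refl) , σ , σ∈base , eq)

    -- The first alternative composes ε-transitions, so one per node is enough in `Match`. The
    -- second simulates a rule at the root; `Direct` suffices there because a further ε-transition
    -- is added by composition.
    Derivable : List (Term × Term) → Term × Term → Set
    Derivable E (u , v) =
      Any (λ (a , b) → a ≡ u × (b , v) ∈ E) E ⊎
      Any (λ (l , r) → Any (λ σ → u ≡ subst σ r × Direct E (λ x c → c ≡ σ x) l v)
                           (assignments (vars l) base)) R

    derivable? : ∀ E p → Dec (Derivable E p)
    derivable? E (u , v) =
      Any.any? (λ (a , b) → a ≟ᵗ u ×-dec (b , v) ∈ᵖ? E) E ⊎-dec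
      Any.any? (λ (l , r) → Any.any? (λ σ → u ≟ᵗ subst σ r ×-dec direct? (λ x c → c ≟ᵗ σ x) l v)
                                     (assignments (vars l) base)) R

    -- The second component prepares the use of GSM: behind an ε-transition stands an instance of a
    -- whole right-hand side, so `α = λ` there and condition (i) holds for every `β`.
    Sound : Term × Term → Set
    Sound (u , v) = Steps R v u × RhsInstance u

    derivable-sound : ∀ {E p} → p ∈ cartesianProduct states states →
                      (∀ {q} → q ∈ E → Sound q) → Derivable E p → Sound p
    derivable-sound _ sound (inj₁ any) with find any
    ... | (a , b) , ab∈E , refl , bv∈E =
      proj₁ (sound bv∈E) ◅◅ proj₁ (sound ab∈E) , proj₂ (sound ab∈E)
    derivable-sound {p = u , v} _ sound (inj₂ any) with find any
    ... | (l , r) , rule , any′ with find any′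
    ...   | σ , σ∈ , refl , d =
      Direct⇒Steps (proj₁ ∘ sound) (λ { x c refl → ε }) d ◅◅ (root rule σ ◅ ε) ,
      l , r , rule , σ ,
      (λ x x∈r → assignments-sound (vars l) σ∈ x (∈-vars⁺ l (isTRS l r rule x x∈r))) , refl

    open Saturation (cartesianProduct states states) Derivable derivable? Sound derivable-sound
      using (saturate)

    εs : List (Term × Term)
    εs = proj₁ saturate

    εs-sound : ∀ {p} → p ∈ εs → Sound p
    εs-sound = proj₁ (proj₂ saturate)

    εs-source : (s , t) ∈ εs → s ∈ states
    εs-source st∈ = RhsInstance⇒states (proj₂ (εs-sound st∈))

    εs-closed : u ∈ states → v ∈ states → Derivable εs (u , v) → (u , v) ∈ εs
    εs-closed u∈ v∈ = proj₂ (proj₂ saturate) (∈-cartesianProduct⁺ u∈ v∈)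

    -- Variables of left-hand sides stand at base terms

    module _ {l₂ r₂ : Term} (rule₂ : (l₂ , r₂) ∈ R) {Q : ℕ → Term → Set} where

      Q∩base : ℕ → Term → Set
      Q∩base x c = Q x c × c ∈ base

      mutual
        -- The descent through `l₂` has two modes. In `base` it stays in `base`, by closure under
        -- arguments. Inside an instance of a right-hand side it follows that side and falls into
        -- `base` at its variables. Crossing an ε-transition restarts the second mode through
        -- `direct-rhs`.
        match-base : ∀ β → l₂ / β ≡ just l → Match εs Q l t → t ∈ base → Match εs Q∩base l t
        match-base β p (leaf q) t∈ = leaf (q , t∈)
        match-base β p (direct d) t∈ = direct (direct-base β p d t∈)
        match-base β p (via st∈ d) t∈ = via st∈ (direct-rhs β p d (proj₂ (εs-sound st∈)))

        direct-base : ∀ β → l₂ / β ≡ just l → Direct εs Q l t → t ∈ base → Direct εs Q∩base l t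
        direct-base β p (node ms) t∈ =
          node λ i → match-base (β ++ toℕ i ∷ []) (/-child l₂ β p i) (ms i) (base-child t∈ i)

        direct-rhs : ∀ β → l₂ / β ≡ just l → Direct εs Q l t → RhsInstance t → Direct εs Q∩base l t
        direct-rhs β p d (l , r , rule , σ , σ∈base , eq)
          with overlap-leaf rule rule₂ [] β refl p (inj₁ refl) d eq
        ... | name , bound = direct-instance β p d name r (l , r , rule , [] , refl) σ∈base eq bound

        -- `bound` is obtained from GSM where the ε-free region starts and handed down from there:
        -- at inner pairs of positions neither need be `λ`, so GSM could not be invoked anew.
        match-instance : ∀ {σ} β → l₂ / β ≡ just l → (m : Match εs Q l t) → ∀ name r →
          SubtermOfRhs r → IntoBase σ r → (eq : t ≡ subst σ r) →
          (∀ γ {x r′} → l / γ ≡ just (var x) → γ ∈POS cut name m r eq →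
             r / γ ≡ just r′ → IsVar r′ ⊎ Ground r′) →
          Match εs Q∩base l t
        -- A variable `r` is sent into `base` by `σ`; a ground `r` is unchanged by `σ` and belongs
        -- to `base` itself.
        match-instance β p (leaf q) name r sub σ∈base eq bound with bound [] refl (_ , refl) refl
        ... | inj₁ (x , refl) = leaf (q , transport (_∈ base) (sym eq) (σ∈base x ([] , refl)))
        ... | inj₂ ground =
          leaf (q , transport (_∈ base) (sym (trans eq (subst-ground r ground))) (base⁺ ground sub))
        match-instance β p (direct d) name r sub σ∈base eq bound =
          direct (direct-instance β p d name r sub σ∈base eq bound)
        match-instance β p (via st∈ d) name r sub σ∈base eq bound =
          via st∈ (direct-rhs β p d (proj₂ (εs-sound st∈)))

        direct-instance : ∀ {σ} β → l₂ / β ≡ just l → (d : Direct εs Q l t) → ∀ name r →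
          SubtermOfRhs r → IntoBase σ r → (eq : t ≡ subst σ r) →
          (∀ γ {x r′} → l / γ ≡ just (var x) → γ ∈POS cutᵈ name d r eq →
             r / γ ≡ just r′ → IsVar r′ ⊎ Ground r′) →
          Direct εs Q∩base l t
        direct-instance β p d name (var x) sub σ∈base eq bound =
          direct-base β p d (transport (_∈ base) (sym eq) (σ∈base x ([] , refl)))
        direct-instance {σ = σ} β p (node {ls = ls} ms) name (app g rs) sub σ∈base refl bound =
          node λ i → match-instance (β ++ toℕ i ∷ []) (/-child l₂ β p i) (ms i)
            (name ∘ (toℕ i ∷_)) (lookup rs i)
            (SubtermOfRhs-child sub i) (λ x x∈ → σ∈base x (∈var-child rs i x∈)) (lookup-substV σ rs i)
            λ γ l/γ (u , c/γ) r/γ → bound (toℕ i ∷ γ) (subV⁺ ls i l/γ)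
              (u , subV-tabulate⁺ _ i c/γ) (subV⁺ rs i r/γ)

      -- At the root of `l₂` the overlap has `β = λ`, so the state may be an instance of a subterm
      -- at any position `α`.
      lhs-binds-base : Direct εs Q l₂ t → t ∈ states → Direct εs Q∩base l₂ t
      lhs-binds-base d t∈ with states⁻ t∈
      ... | inj₁ t∈base = direct-base [] refl d t∈base
      ... | inj₂ (s , sub@(l , r , rule , α , p) , σ , σ∈base , eq)
        with overlap-leaf rule rule₂ α [] p refl (inj₂ refl) d eq
      ...   | name , bound = direct-instance [] refl d name s sub σ∈base eq bound

    -- Closure of runs under rewriting

    Reaches : Term → Term → Set
    Reaches = Match εs (λ _ _ → ⊥)

    -- `via` holds a single ε-transition; two in a row are merged by saturation.
    Reaches-ε : Reaches u s → (s , t) ∈ εs → t ∈ states → Reaches u t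
    Reaches-ε (leaf ()) st∈ t∈
    Reaches-ε (direct d) st∈ t∈ = via st∈ d
    Reaches-ε (via as∈ d) st∈ t∈ = via (εs-closed (εs-source as∈) t∈ (inj₁ (lose as∈ (refl , st∈)))) d

    Reaches-ground : Ground t → Reaches t t
    Reaches-ground {t} ground = transport (λ u → Reaches u u) (subst-var t)
      (Match-subst t λ x x∈t → contradiction x∈t (ground x))

    Reaches⇒Steps : Reaches u t → Steps R t u
    Reaches⇒Steps {u} m =
      transport (Steps R _) (subst-var u) (Match⇒Steps (proj₁ ∘ εs-sound) (λ _ _ ()) m)

    -- Cutting the run at the variables of `l` leaves each `τ x` at a base term `ρ x`, which a
    -- listed `σ` reproduces. Then `τ(r)` runs to the state `σ(r)`, and saturation contains the
    -- ε-transition from `σ(r)` to `t`.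
    Reaches-root : ∀ {τ} → (l , r) ∈ R → t ∈ states →
                   Direct εs (λ _ _ → ⊥) (subst τ l) t → Reaches (subst τ r) t
    Reaches-root {var x} rule t∈ d = contradiction (x , refl) (proj₁ gsm _ _ rule)
    Reaches-root {l@(app f ls)} {r} {t} {τ} rule t∈ d
      with Direct-choice (leftLinear _ _ rule) (lhs-binds-base rule (Direct-unsubst f ls d) t∈)
    ... | ρ , bound , d′ with assignments-complete (vars l) ρ (λ x x∈ → proj₂ (bound x (∈-vars⁻ l x∈)))
    ...   | σ , σ∈ , ρ≡σ = Reaches-ε reaches (εs-closed (RhsInstance⇒states inst) t∈ derivable) t∈
      where
      inst : RhsInstance (subst σ r)
      inst = l , r , rule , σ ,
        (λ x x∈r → assignments-sound (vars l) σ∈ x (∈-vars⁺ l (isTRS l r rule x x∈r))) , refl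
      derivable : Derivable εs (subst σ r , t)
      derivable = inj₂ (lose rule (lose σ∈
        (refl , Direct-map (λ x c x∈ eq → trans eq (ρ≡σ x (∈-vars⁺ l x∈))) d′)))
      reaches : Reaches (subst τ r) (subst σ r)
      reaches = Match-subst r λ x x∈r → let x∈l = isTRS l r rule x x∈r in
        transport (Reaches (τ x)) (ρ≡σ x (∈-vars⁺ l x∈l)) (proj₁ (bound x x∈l))

    mutual
      Reaches-step : Step R u v → t ∈ states → Reaches u t → Reaches v t
      Reaches-step st t∈ (leaf ())
      Reaches-step st t∈ (direct d) = Direct-step st t∈ d
      -- The step is simulated below the source of the final ε-transition, which is appended again.
      Reaches-step st t∈ (via e d) = Reaches-ε (Direct-step st (εs-source e) d) e t∈

      Direct-step : Step R u v → t ∈ states → Direct εs (λ _ _ → ⊥) u t → Reaches v t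
      Direct-step (root rule σ) t∈ d = Reaches-root rule t∈ d
      Direct-step (inside f us i {v} st) t∈ (node {ts = ts} ms) = direct (node ms′)
        where
        ms′ : ∀ j → Reaches (lookup (us [ i ]≔ v) j) (lookup ts j)
        ms′ j with j ≟ᶠ i
        ... | yes refl = transport (λ u → Reaches u _) (sym (lookup∘update i us v))
                           (Reaches-step st (states-child t∈ i) (ms i))
        ... | no j≢i = transport (λ u → Reaches u _) (sym (lookup∘update′ j≢i us v)) (ms j)

    Reaches-steps : Steps R u v → t ∈ states → Reaches u t → Reaches v t
    Reaches-steps ε t∈ m = m
    Reaches-steps (st ◅ sts) t∈ m = Reaches-steps sts t∈ (Reaches-step st t∈ m)

    -- The automaton

    State : Set
    State = Fin (length states)

    term : State → Term
    term = List.lookup states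

    stateOf : t ∈ states → ∃[ a ] (term a ≡ t)
    stateOf t∈ = index t∈ , sym (lookup-index t∈)

    vectors : ∀ n → List (Vec State n)
    vectors zero = [] ∷ []
    vectors (suc n) = concatMap (λ a → map (a ∷_) (vectors n)) (allFin _)

    ∈-vectors : (as : Vec State n) → as ∈ vectors n
    ∈-vectors [] = here refl
    ∈-vectors (a ∷ as) = ∈-concatMap⁺ _ (lose (∈-allFin a) (∈-map⁺ _ (∈-vectors as)))

    Transition : Set
    Transition = Σ[ f ∈ Sym ] (Vec State (rank f) × State)

    IsTransition : Transition → Set
    IsTransition (f , as , a) = term a ≡ app f (Vec.map term as)

    transitionsOf : Sym → List Transition
    transitionsOf f = map (f ,_) (cartesianProduct (vectors (rank f)) (allFin _))

    isTransition? : ∀ δ → Dec (IsTransition δ)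
    isTransition? (f , as , a) = term a ≟ᵗ app f (Vec.map term as)

    isε? : ∀ ab → Dec ((term (proj₁ ab) , term (proj₂ ab)) ∈ εs)
    isε? (a , b) = (term a , term b) ∈ᵖ? εs

    accepting? : ∀ a → Dec (term a ∈ L)
    accepting? a = term a ∈ᵗ? L

    automaton : BTA
    automaton = record
      { nstates = length states
      ; rules   = filter isTransition? (concatMap transitionsOf Σ')
      ; εrules  = filter isε? (cartesianProduct (allFin _) (allFin _))
      ; finals  = filter accepting? (allFin _)
      }

    automaton-over : BTAOver Σ' automaton
    automaton-over f as a δ∈
      with find (∈-concatMap⁻ transitionsOf {xs = Σ'}
             (proj₁ (∈-filter⁻ isTransition? {xs = concatMap transitionsOf Σ'} δ∈)))
    ... | g , g∈Σ' , δ∈′ with ∈-map⁻ _ δ∈′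
    ...   | _ , _ , refl = g∈Σ'

    Run⇒Reaches : ∀ {a} → Run automaton u a → Reaches u (term a)
    Run⇒Reaches (move {f} {as} {a} δ∈ us runs) =
      transport (Reaches _) (sym (proj₂ (∈-filter⁻ isTransition? {xs = concatMap transitionsOf Σ'} δ∈)))
        (direct (node λ i → transport (Reaches _) (sym (lookup-map i term as)) (Run⇒Reaches (runs i))))
    Run⇒Reaches (εmove {a' = a'} run e) =
      Reaches-ε (Run⇒Reaches run)
        (proj₂ (∈-filter⁻ isε? {xs = cartesianProduct (allFin _) (allFin _)} e)) (∈-lookup a')

    mutual
      -- The list `states` may repeat a term, so the run is built for every index `a` of `t`.
      Reaches⇒Run : Reaches u t → t ∈ states → ∀ a → term a ≡ t → Run automaton u a
      Reaches⇒Run (leaf ()) t∈ a eq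
      Reaches⇒Run (direct d) t∈ a eq = Direct⇒Run d t∈ a eq
      Reaches⇒Run (via st∈ d) t∈ a refl with stateOf (εs-source st∈)
      ... | b , refl = εmove (Direct⇒Run d (εs-source st∈) b refl)
        (∈-filter⁺ isε? (∈-cartesianProduct⁺ (∈-allFin b) (∈-allFin a)) st∈)

      Direct⇒Run : Direct εs (λ _ _ → ⊥) u t → t ∈ states → ∀ a → term a ≡ t → Run automaton u a
      Direct⇒Run (node {f} {us} {ts} ms) t∈ a eq = move δ∈ us runs
        where
        arg : ∀ i → ∃[ b ] (term b ≡ lookup ts i)
        arg i = stateOf (states-child t∈ i)
        as : Vec State (rank f)
        as = tabulate (proj₁ ∘ arg)
        as-terms : Vec.map term as ≡ ts
        as-terms = lookup-ext λ i → trans (lookup-map i term as)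
          (trans (cong term (lookup∘tabulate _ i)) (proj₂ (arg i)))
        δ∈ : (f , as , a) ∈ rules automaton
        δ∈ = ∈-filter⁺ isTransition?
          (∈-concatMap⁺ transitionsOf (lose (states-over t∈)
            (∈-map⁺ _ (∈-cartesianProduct⁺ (∈-vectors as) (∈-allFin a)))))
          (trans eq (cong (app f) (sym as-terms)))
        runs : ∀ i → Run automaton (lookup us i) (lookup as i)
        runs i = Reaches⇒Run (ms i) (states-child t∈ i) (lookup as i)
          (trans (cong term (lookup∘tabulate _ i)) (proj₂ (arg i)))

    -- Acceptance also demands a ground term over `Σ'`; this follows from the run alone, as every
    -- position is read by a transition.
    Run-subterm : ∀ {a} → Run automaton u a → ∀ α → u / α ≡ just s →
                  ∃[ f ] ∃[ ts ] (s ≡ app f ts × f ∈ Σ')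
    Run-subterm (εmove run _) α p = Run-subterm run α p
    Run-subterm (move δ∈ us runs) [] refl = _ , _ , refl , automaton-over _ _ _ δ∈
    Run-subterm (move δ∈ us runs) (k ∷ α) p with subV⁻ us k p
    ... | i , _ , q = Run-subterm (runs i) α q

    Run⇒GroundOver : ∀ {a} → Run automaton u a → GroundOver Σ' u
    Run⇒GroundOver run =
      (λ { x (α , p) → not-var (Run-subterm run α p) }) ,
      (λ { f (α , ts , p) → symbol (Run-subterm run α p) })
      where
      not-var : ∀ {x} → ¬ (∃[ f ] ∃[ ts ] (var x ≡ app f ts × f ∈ Σ'))
      not-var (_ , _ , () , _)
      symbol : ∀ {f ts} → ∃[ g ] ∃[ us ] (app f ts ≡ app g us × g ∈ Σ') → f ∈ Σ'
      symbol (_ , _ , refl , f∈) = f∈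

    accepts⇒descendant : Accepts Σ' automaton t → InDescendants R L t
    accepts⇒descendant (_ , a , a∈ , run) =
      term a , proj₂ (∈-filter⁻ accepting? {xs = allFin _} a∈) , Reaches⇒Steps (Run⇒Reaches run)

    descendant⇒accepts : InDescendants R L t → Accepts Σ' automaton t
    descendant⇒accepts {t} (q , q∈L , steps) = Run⇒GroundOver run , a , a∈ , run
      where
      q∈ : q ∈ states
      q∈ = base⊆states (L⊆base q∈L)
      a : State
      a = proj₁ (stateOf q∈)
      a≡q : term a ≡ q
      a≡q = proj₂ (stateOf q∈)
      a∈ : a ∈ finals automaton
      a∈ = ∈-filter⁺ accepting? (∈-allFin a) (transport (_∈ L) (sym a≡q) q∈L)
      run : Run automaton t a
      run = Reaches⇒Run (Reaches-steps steps q∈ (Reaches-ground (proj₁ (All.lookup L-over q∈L)))) q∈ a a≡q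

mainTheorem1 : (R : TRS) → IsTRS R → LeftLinear R → GSM R → EPRF R
mainTheorem1 R isTRS leftLinear gsm Σ' sign L L-over =
  automaton , automaton-over , λ t → mk⇔ accepts⇒descendant descendant⇒accepts
  where open Construction isTRS leftLinear gsm Σ' sign L L-over
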